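{- Let $n\ge1$ and let $H$ be dense in $\widehat{\mathcal F_n}$. Then $$\mathcal O\big(\mathrm{Spec}^0_\downarrow(H)\big)=\mathcal O_\downarrow\big(\mathrm{Spec}^0_\downarrow(H),\subseteq\big),$$ that is, the Zariski topology on the principal ideal spectrum of $H$ is the topology whose open sets are exactly the sets of principal prime ideals that are decreasing with respect to inclusion.
   Context: Fix $n\ge1$ and symbols $P_1,\dots,P_n$. The partially ordered set $(K_n,\le)$ with valuation map $\mathrm{val}:K_n\to\mathfrak P(\{P_1,\dots,P_n\})$ is the increasing union of finite sets $K_n^d$ ($d\ge 0$) built recursively: $K_n^{ -1}=\emptyset$, and $K_n^d\setminus K_n^{d-1}$ consists of exactly one point $w_{\beta,Y}$ for each pair $(\beta,Y)$ such that (i) $Y$ is a decreasing subset of $K_n^{d-1}$ with $Y\not\subseteq K_n^{d-2}$ (for $d=0$ this last condition is void, so $Y=\emptyset$); (ii) $\beta\subseteq\{P_1,\dots,P_n\}$ and $\beta\subseteq\mathrm{val}(w')$ for all $w'\in Y$; (iii) if $Y$ is the decreasing set generated by a single element $w_{\beta',Y'}$, then $\beta\ne\beta'$. One sets $\mathrm{val}(w_{\beta,Y})=\beta$, and $w\le w_{\beta,Y}$ iff $w\in Y$ or $w=w_{\beta,Y}$. $\widehat{\mathcal F_n}:=\mathcal O_\downarrow(K_n,\le)$ is the Heyting algebra of all decreasing subsets of $K_n$ ($\sqcap=\cap$, $\sqcup=\cup$, $a\to b$ = the largest decreasing set contained in $(K_n\setminus a)\cup b$). It carries the metric $\mathrm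 d(a,b)=2^{ -\min\{i\in\mathbb N\mid a\cap K_n^i\neq b\cap K_n^i\}}$ ($2^{ -\min\emptyset}=0$). "$H$ is dense in $\widehat{\mathcal F_n}$" means that $H$ is a Heyting sub-algebra of $\widehat{\mathcal F_n}$ that is dense for this metric; equivalently, all maps $H\to\mathcal O_\downarrow(K_n^d,\le)$, $a\mapsto a\cap K_n^d$, are surjective. A principal ideal of a lattice is a set $(x)_\downarrow=\{y: y\le x\}$ with $x\ne1$. $\mathrm{Spec}^0_\downarrow(H)$ is the set of all principal prime ideals of $H$, with the trace of the Zariski topology; i.e. a basis of open sets is given by the sets $\{\mathfrak i\in\mathrm{Spec}^0_\downarrow(H)\mid a\notin\mathfrak i\}$ for $a\in H$. $\mathcal O(X)$ denotes the lattice of open sets of a topological space $X$, and $\mathcal O_\downarrow(X,\le)$ the lattice of decreasing subsets of a partially ordered set. -}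

module Defs where

open import Data.Bool using (Bool; T)
open import Data.Empty using (⊥; ⊥-elim)
open import Data.Fin.Subset using (Subset)
import Data.Fin.Subset as Subset
open import Data.Nat using (ℕ; zero; suc)
import Data.Nat as ℕ
import Data.Nat.Properties as ℕ
open import Data.Product using (Σ; ∃; ∃-syntax; _×_; _,_; proj₁; proj₂)
open import Data.Rational using (ℚ; 0ℚ; 1ℚ; ½; _*_; _<_)
open import Data.Sum using (_⊎_; inj₁; inj₂; [_,_]′)
open import Data.Unit using (⊤; tt)
open import Function using (_∘_)
open import Level using (Level; _⊔_; 0ℓ) renaming (suc to lsuc)
open import Relation.Binary using (Rel; Poset; IsPartialOrder; _Respects_)
open import Relation.Binary.Lattice using (HeytingAlgebra)
open import Relation.Binary.PropositionalEquality using (_≡_; _≢_; refl; sym; trans)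
open import Relation.Nullary using (¬_)
open import Relation.Unary using (Pred; _∈_; _∉_; _⊆_; _≐_; _∩_; _∪_; ∅; U)

private
  variable
    a c h ℓ ℓ₁ ℓ₂ u : Level

IsDecreasing : {A : Set a} → Rel A ℓ → Pred (Pred A u) (a ⊔ ℓ ⊔ u)
IsDecreasing _≤_ D = ∀ {x y} → x ≤ y → y ∈ D → x ∈ D

------------------------------------------------------------------------
-- The poset K n

module Bellissima (n : ℕ) where

  -- `fresh` expresses the condition Y ⊈ Kᵈ⁻² on subsets Y of Kᵈ⁻¹.
  record Stage : Set₁ where
    field
      Carrier : Set
      _≤_     : Rel Carrier 0ℓ
      val     : Carrier → Subset n
      fresh   : Pred (Pred Carrier 0ℓ) 0ℓ

  -- The pairs (β , Y) over a stage S = Kᵈ⁻¹, i.e. the points of Kᵈ ∖ Kᵈ⁻¹.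
  -- Since Kᵈ⁻¹ is finite, its subsets are given by Boolean functions.
  record NewPoint (S : Stage) : Set where
    open Stage S
    field
      β : Subset n
      χ : Carrier → Bool

    Y : Pred Carrier 0ℓ
    Y = T ∘ χ

    field
      Y-decreasing : IsDecreasing _≤_ Y
      Y-fresh      : fresh Y
      β⊆val        : ∀ {w} → w ∈ Y → β Subset.⊆ val w
      β≢val        : ∀ {w} → Y ≐ (_≤ w) → β ≢ val w

  -- Equality of pairs (β , Y): the sets Y are compared extensionally.
  _≋_ : ∀ {S} → Rel (NewPoint S) 0ℓ
  p ≋ q = NewPoint.β p ≡ NewPoint.β q × NewPoint.Y p ≐ NewPoint.Y q

  emptyStage : Stage
  emptyStage = record
    { Carrier = ⊥ ; _≤_ = λ () ; val = λ () ; fresh = λ _ → ⊤ }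

  extend : Stage → Stage
  extend S = record
    { Carrier = Stage.Carrier S ⊎ NewPoint S
    ; _≤_     = _≤′_
    ; val     = [ Stage.val S , NewPoint.β ]′
    ; fresh   = λ Y → ¬ (Y ⊆ λ w → ∃[ v ] w ≡ inj₁ v)
    }
    where
    _≤′_ : Rel (Stage.Carrier S ⊎ NewPoint S) 0ℓ
    inj₁ v ≤′ inj₁ w = Stage._≤_ S v w
    inj₁ v ≤′ inj₂ q = v ∈ NewPoint.Y q
    inj₂ p ≤′ inj₁ w = ⊥
    inj₂ p ≤′ inj₂ q = p ≋ q

  -- stage d is Kᵈ⁻¹.
  stage : ℕ → Stage
  stage zero    = emptyStage
  stage (suc d) = extend (stage d)

  -- The union of the Kᵈ, as the disjoint union of the Kᵈ ∖ Kᵈ⁻¹.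
  K : Set
  K = Σ ℕ λ d → NewPoint (stage d)

  level : K → ℕ
  level = proj₁

  val : K → Subset n
  val (_ , p) = NewPoint.β p

  K^ : ℕ → Pred K 0ℓ
  K^ d w = level w ℕ.≤ d

  -- The inclusion of Kᵈ⁻¹ in K.
  point : ∀ {d} → Stage.Carrier (stage d) → K
  point {suc d} (inj₁ v) = point {d} v
  point {suc d} (inj₂ p) = d , p

  infix 4 _≈_ _≼_

  data _≈_ : Rel K 0ℓ where
    same : ∀ {d} {p q : NewPoint (stage d)} → p ≋ q → (d , p) ≈ (d , q)

  data _≼_ : Rel K 0ℓ where
    equal : ∀ {v w} → v ≈ w → v ≼ w
    below : ∀ {d} {q : NewPoint (stage d)} {v} →
            v ∈ NewPoint.Y q → point {d} v ≼ (d , q)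

  ≋-refl : ∀ {S} {p : NewPoint S} → p ≋ p
  ≋-refl = refl , (λ y → y) , (λ y → y)

  ≋-sym : ∀ {S} {p q : NewPoint S} → p ≋ q → q ≋ p
  ≋-sym (e , f , g) = sym e , g , f

  ≋-trans : ∀ {S} {p q r : NewPoint S} → p ≋ q → q ≋ r → p ≋ r
  ≋-trans (e , f , g) (e′ , f′ , g′) =
    trans e e′ , (λ y → f′ (f y)) , (λ y → g (g′ y))

  ≈-refl : ∀ {v} → v ≈ v
  ≈-refl {_ , p} = same (≋-refl {p = p})

  ≈-sym : ∀ {v w} → v ≈ w → w ≈ v
  ≈-sym (same {p = p} {q} e) = same (≋-sym {p = p} {q} e)

  ≈-trans : ∀ {v w x} → v ≈ w → w ≈ x → v ≈ x
  ≈-trans (same {p = p} {q} e) (same {q = r} f) =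
    same (≋-trans {p = p} {q} {r} e f)

  level-point : ∀ d (v : Stage.Carrier (stage d)) → level (point {d} v) ℕ.< d
  level-point (suc d) (inj₁ v) = ℕ.m<n⇒m<1+n (level-point d v)
  level-point (suc d) (inj₂ p) = ℕ.n<1+n d

  ≼⇒≈⊎< : ∀ {v w} → v ≼ w → v ≈ w ⊎ level v ℕ.< level w
  ≼⇒≈⊎< (equal e)             = inj₁ e
  ≼⇒≈⊎< (below {d} {v = v} _) = inj₂ (level-point d v)

  ≼-point : ∀ {x} d (w : Stage.Carrier (stage d)) → x ≼ point {d} w →
            ∃[ v ] (point {d} v ≡ x × Stage._≤_ (stage d) v w)
  ≼-point (suc d) (inj₁ w) x≼w with ≼-point d w x≼w
  ... | v , e , v≤w = inj₁ v , e , v≤w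
  ≼-point (suc d) (inj₂ q) (equal (same {p = p} e)) = inj₂ p , refl , e
  ≼-point (suc d) (inj₂ q) (below {v = v} y)        = inj₁ v , refl , y

  ≼-trans : ∀ {v w x} → v ≼ w → w ≼ x → v ≼ x
  ≼-trans (equal e)        (equal f) = equal (≈-trans e f)
  ≼-trans (below y)        (equal (same (_ , f , _))) = below (f y)
  ≼-trans v≼w              (below {d} {q} {w} y) with ≼-point d w v≼w
  ... | v , refl , v≤w = below (NewPoint.Y-decreasing q v≤w y)

  ≼-antisym : ∀ {v w} → v ≼ w → w ≼ v → v ≈ w
  ≼-antisym v≼w w≼v with ≼⇒≈⊎< v≼w | ≼⇒≈⊎< w≼v
  ... | inj₁ e | _      = e
  ... | inj₂ _ | inj₁ e = ≈-sym e
  ... | inj₂ l | inj₂ m = ⊥-elim (ℕ.<-asym l m)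

  poset : Poset 0ℓ 0ℓ 0ℓ
  poset = record
    { _≈_ = _≈_
    ; _≤_ = _≼_
    ; isPartialOrder = record
      { isPreorder = record
        { isEquivalence = record
          { refl = ≈-refl ; sym = ≈-sym ; trans = ≈-trans }
        ; reflexive = equal
        ; trans     = ≼-trans
        }
      ; antisym = ≼-antisym
      }
    }

------------------------------------------------------------------------
-- Heyting algebras

module _ (P : Poset 0ℓ 0ℓ 0ℓ) where
  open Poset P using (Carrier; _≤_) renaming (refl to ≤-refl; trans to ≤-trans)

  record DownSet : Set₁ where
    constructor downSet
    field
      members    : Pred Carrier 0ℓ
      decreasing : IsDecreasing _≤_ members

  open DownSet

  -- w ∈ A ⇒ B iff every v ≤ w lies in (P ∖ A) ∪ B, so that A ⇒ B is the
  -- largest decreasing set contained in (P ∖ A) ∪ B.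
  _⇒_ : DownSet → DownSet → DownSet
  A ⇒ B = downSet (λ w → ∀ {v} → v ≤ w → v ∈ members A → v ∈ members B)
                  (λ x≤y f v≤x → f (≤-trans v≤x x≤y))

  downSets : HeytingAlgebra (lsuc 0ℓ) 0ℓ 0ℓ
  downSets = record
    { Carrier = DownSet
    ; _≈_ = λ A B → members A ≐ members B
    ; _≤_ = λ A B → members A ⊆ members B
    ; _∨_ = λ A B → downSet (members A ∪ members B)
        (λ { x≤y (inj₁ y∈A) → inj₁ (decreasing A x≤y y∈A)
           ; x≤y (inj₂ y∈B) → inj₂ (decreasing B x≤y y∈B) })
    ; _∧_ = λ A B → downSet (members A ∩ members B)
        (λ x≤y (y∈A , y∈B) → decreasing A x≤y y∈A , decreasing B x≤y y∈B)
    ; _⇨_ = _⇒_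
    ; ⊤ = downSet U (λ _ _ → tt)
    ; ⊥ = downSet ∅ (λ _ ())
    ; isHeytingAlgebra = record
      { isBoundedLattice = record
        { isLattice = record
          { isPartialOrder = record
            { isPreorder = record
              { isEquivalence = record
                { refl  = (λ x → x) , (λ x → x)
                ; sym   = λ (f , g) → g , f
                ; trans = λ (f , g) (f′ , g′) →
                    (λ x → f′ (f x)) , (λ x → g (g′ x))
                }
              ; reflexive = proj₁
              ; trans     = λ f g x → g (f x)
              }
            ; antisym = λ f g → f , g
            }
          ; supremum = λ A B → inj₁ , inj₂ , λ C f g → λ
              { (inj₁ x) → f x ; (inj₂ x) → g x }
          ; infimum  = λ A B → proj₁ , proj₂ , λ C f g x → f x , g x
          }
        ; maximum = λ _ _ → tt
        ; minimum = λ _ ()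
        }
      ; exponential = λ C A B →
            (λ f w∈C v≤w v∈A → f (decreasing C v≤w w∈C , v∈A))
          , (λ f (w∈C , w∈A) → f w∈C ≤-refl w∈A)
      }
    }

module _ (L : HeytingAlgebra c ℓ₁ ℓ₂) where
  open HeytingAlgebra L hiding (refl; trans)

  record IsSubalgebra (H : Pred Carrier h) : Set (c ⊔ ℓ₁ ⊔ h) where
    field
      resp     : H Respects _≈_
      ∨-closed : ∀ {x y} → x ∈ H → y ∈ H → x ∨ y ∈ H
      ∧-closed : ∀ {x y} → x ∈ H → y ∈ H → x ∧ y ∈ H
      ⇨-closed : ∀ {x y} → x ∈ H → y ∈ H → x ⇨ y ∈ H
      ⊤-closed : HeytingAlgebra.⊤ L ∈ H
      ⊥-closed : HeytingAlgebra.⊥ L ∈ H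

  subalgebra : {H : Pred Carrier h} → IsSubalgebra H →
               HeytingAlgebra (c ⊔ h) ℓ₁ ℓ₂
  subalgebra {H = H} S = record
    { Carrier = Σ Carrier H
    ; _≈_ = λ x y → proj₁ x ≈ proj₁ y
    ; _≤_ = λ x y → proj₁ x ≤ proj₁ y
    ; _∨_ = λ (x , x∈H) (y , y∈H) → x ∨ y , ∨-closed x∈H y∈H
    ; _∧_ = λ (x , x∈H) (y , y∈H) → x ∧ y , ∧-closed x∈H y∈H
    ; _⇨_ = λ (x , x∈H) (y , y∈H) → x ⇨ y , ⇨-closed x∈H y∈H
    ; ⊤ = _ , ⊤-closed
    ; ⊥ = _ , ⊥-closed
    ; isHeytingAlgebra = record
      { isBoundedLattice = record
        { isLattice = record
          { isPartialOrder = record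
            { isPreorder = record
              { isEquivalence = record
                { refl  = Eq.refl
                ; sym   = Eq.sym
                ; trans = Eq.trans
                }
              ; reflexive = reflexive
              ; trans     = HeytingAlgebra.trans L
              }
            ; antisym = antisym
            }
          ; supremum = λ (x , _) (y , _) →
              let p , q , r = supremum x y in p , q , λ (z , _) → r z
          ; infimum  = λ (x , _) (y , _) →
              let p , q , r = infimum x y in p , q , λ (z , _) → r z
          }
        ; maximum = λ (x , _) → maximum x
        ; minimum = λ (x , _) → minimum x
        }
      ; exponential = λ (w , _) (x , _) (y , _) → exponential w x y
      }
    }
    where open IsSubalgebra S

------------------------------------------------------------------------
-- The principal ideal spectrum

module PrincipalSpectrum (L : HeytingAlgebra c ℓ₁ ℓ₂) where
  open HeytingAlgebra L

  IsPrincipalIdeal : Pred (Pred Carrier ℓ₂) (c ⊔ ℓ₁ ⊔ ℓ₂)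
  IsPrincipalIdeal 𝔦 =
    ∃[ x ] (¬ x ≈ HeytingAlgebra.⊤ L × 𝔦 ≐ (_≤ x))

  IsPrime : Pred (Pred Carrier ℓ₂) (c ⊔ ℓ₂)
  IsPrime 𝔦 = ∀ x y → x ∧ y ∈ 𝔦 → x ∈ 𝔦 ⊎ y ∈ 𝔦

  record Spec⁰ : Set (c ⊔ ℓ₁ ⊔ lsuc ℓ₂) where
    field
      ideal     : Pred Carrier ℓ₂
      principal : IsPrincipalIdeal ideal
      prime     : IsPrime ideal

  open Spec⁰

  _⊆ˢ_ : Rel Spec⁰ (c ⊔ ℓ₂)
  𝔦 ⊆ˢ 𝔧 = ideal 𝔦 ⊆ ideal 𝔧

  Basic : Carrier → Pred Spec⁰ ℓ₂
  Basic x 𝔦 = x ∉ ideal 𝔦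

  IsOpen : Pred (Pred Spec⁰ u) (c ⊔ ℓ₁ ⊔ lsuc ℓ₂ ⊔ u)
  IsOpen V = ∀ {𝔦} → 𝔦 ∈ V → ∃[ x ] (𝔦 ∈ Basic x × Basic x ⊆ V)

------------------------------------------------------------------------
-- The metric on F̂ n and density

F̂ : ℕ → HeytingAlgebra (lsuc 0ℓ) 0ℓ 0ℓ
F̂ n = downSets (Bellissima.poset n)

2^- : ℕ → ℚ
2^- zero    = 1ℚ
2^- (suc m) = ½ * 2^- m

module _ (n : ℕ) where
  open HeytingAlgebra (F̂ n) using (Carrier)
  open Bellissima n using (K^)
  open DownSet

  DifferAt : Carrier → Carrier → Pred ℕ 0ℓ
  DifferAt A B i = ¬ (members A ∩ K^ i ≐ members B ∩ K^ i)

  -- The graph of the metric: IsDistance A B r means d(A , B) = r.  The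
  -- minimum defining d(A , B) cannot be computed constructively.
  data IsDistance (A B : Carrier) : Pred ℚ 0ℓ where
    differ : ∀ {m} → DifferAt A B m → (∀ {i} → DifferAt A B i → m ℕ.≤ i) →
             IsDistance A B (2^- m)
    agree  : (∀ i → ¬ DifferAt A B i) → IsDistance A B 0ℚ

  record IsDense (H : Pred Carrier h) : Set (lsuc 0ℓ ⊔ h) where
    field
      isSubalgebra : IsSubalgebra (F̂ n) H
      dense        : ∀ A ε → 0ℚ < ε →
                     ∃[ B ] (B ∈ H × ∃[ r ] (IsDistance A B r × r < ε))

{-# OPTIONS --safe #-}

-- If B is a decreasing set contained in Kᵈ, then B is the only decreasing
-- set with trace B on Kᵈ⁺¹; hence B belongs to every dense H.  In particular
-- H contains w↓ and w↓ ∖ {w} for every point w, and therefore also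
-- w↓ → (w↓ ∖ {w}) = K ∖ w↑.  If a generates a prime ideal of H and w is
-- minimal outside a, then w↓ ∩ (K ∖ w↑) ⊆ a forces a = K ∖ w↑, so the
-- principal ideals not containing w↓ are exactly those contained in (a)↓.
module Submission where

open import Defs
open import Axiom.ExcludedMiddle using (ExcludedMiddle)
open import Data.Empty using (⊥-elim)
open import Data.Nat
  using (ℕ; zero; suc; _≤_; _<_; _≥_; _≤?_; z≤n; s≤s; z<s; s<s)
open import Data.Nat.Induction using (<-wellFounded)
import Data.Nat.Properties as ℕ
open import Data.Product using (∃-syntax; _×_; _,_; proj₁; proj₂)
open import Data.Rational using (1ℚ; ½; 0ℚ)
import Data.Rational as ℚ
import Data.Rational.Properties as ℚ
open import Data.Sum using (inj₁; inj₂)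
open import Data.Unit using (tt)
open import Function using (_∘_)
open import Induction.WellFounded using (Acc; acc)
open import Level using (0ℓ)
open import Relation.Binary.Lattice using (HeytingAlgebra)
open import Relation.Binary.PropositionalEquality using (_≡_; refl)
open import Relation.Nullary using (¬_; yes; no; contradiction)
open import Relation.Nullary.Decidable using (decidable-stable; from-yes)
open import Relation.Unary using (Pred; _∈_; _∉_; _⊆_; _≐_; _∩_)

2^->0 : ∀ m → 0ℚ ℚ.< 2^- m
2^->0 zero    = from-yes (0ℚ ℚ.<? 1ℚ)
2^->0 (suc m) = ℚ.*-monoʳ-<-pos ½ (2^->0 m)

2^-≤1 : ∀ m → 2^- m ℚ.≤ 1ℚ
2^-≤1 zero    = ℚ.≤-refl
2^-≤1 (suc m) = ℚ.≤-trans (ℚ.*-monoˡ-≤-nonNeg ½ (2^-≤1 m))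
                          (from-yes (½ ℚ.* 1ℚ ℚ.≤? 1ℚ))

2^-cancel-< : ∀ m k → 2^- m ℚ.< 2^- k → k < m
2^-cancel-< zero    k       1<2^-k =
  contradiction (ℚ.<-≤-trans 1<2^-k (2^-≤1 k)) (ℚ.<-irrefl refl)
2^-cancel-< (suc m) zero    _      = z<s
2^-cancel-< (suc m) (suc k) lt     =
  s<s (2^-cancel-< m k (ℚ.*-cancelˡ-<-nonNeg ½ lt))

module Density (em : ExcludedMiddle 0ℓ) (n : ℕ) where
  open Bellissima n
  open HeytingAlgebra (F̂ n) using (Carrier; _⇨_)
  open module DownSetₙ A = DownSet {poset} A

  -- If the traces on `K^ k` differed, `least` would give `m` ≤ `k`, whereas the bound on the
  -- distance forces `k` < `m`.
  distance<⇒trace≐ : ∀ {A B r} k → IsDistance n A B r → r ℚ.< 2^- k →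
                     members A ∩ K^ k ≐ members B ∩ K^ k
  distance<⇒trace≐ k (differ {m} _ least) r<2^-k = decidable-stable em
    λ differs → ℕ.<⇒≱ (2^-cancel-< m k r<2^-k) (least differs)
  distance<⇒trace≐ k (agree agrees) _ = decidable-stable em (agrees k)

  -- By freshness of Y, a point of level e + 1 has a point of level e below it.
  trace⊆⇒⊆ : ∀ {d} A B → members A ∩ K^ (suc d) ⊆ members B →
             members B ⊆ K^ d → members A ⊆ members B
  trace⊆⇒⊆ {d} A B trace⊆B B⊆K^d {e , p} = go e p
    where
    go : ∀ e (p : NewPoint (stage e)) →
         (e , p) ∈ members A → (e , p) ∈ members B
    go zero    p p∈A = trace⊆B (p∈A , z≤n)
    go (suc e) p p∈A with e ≤? d
    ... | yes e≤d = trace⊆B (p∈A , s≤s e≤d)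
    ... | no  e≰d = ⊥-elim (NewPoint.Y-fresh p Y-old)
      where
      Y-old : NewPoint.Y p ⊆ λ w → ∃[ v ] w ≡ inj₁ v
      Y-old {inj₁ v} _   = v , refl
      -- Such a `q` has level `e` and lies in `A`, so by recursion in `B`, which has no points above
      -- level `d`.
      Y-old {inj₂ q} q∈Y = contradiction
        (B⊆K^d (go e q (decreasing A (below {q = p} q∈Y) p∈A))) e≰d

  infix 8 _↓ _⇓

  _↓ : K → Carrier
  w ↓ = downSet (_≼ w) ≼-trans

  ≼⇒level≤ : ∀ {v w} → v ≼ w → level v ≤ level w
  ≼⇒level≤ v≼w with ≼⇒≈⊎< v≼w
  ... | inj₁ (same _) = ℕ.≤-refl
  ... | inj₂ v<w      = ℕ.<⇒≤ v<w

  -- This is `w ↓` without `w`: points below `w` and distinct from it have smaller level. Comparing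
  -- levels avoids a negated equality and feeds the descent in `minimal-∉`.
  _⇓ : K → Carrier
  w ⇓ = downSet (λ v → v ≼ w × level v < level w)
    λ x≼y (y≼w , y<w) → ≼-trans x≼y y≼w , ℕ.≤-<-trans (≼⇒level≤ x≼y) y<w

  ⋠⇒∈↓⇨⇓ : ∀ {v w} → ¬ w ≼ v → v ∈ members (w ↓ ⇨ w ⇓)
  ⋠⇒∈↓⇨⇓ w⋠v x≼v x≼w with ≼⇒≈⊎< x≼w
  ... | inj₁ x≈w = contradiction (≼-trans (equal (≈-sym x≈w)) x≼v) w⋠v
  ... | inj₂ x<w = x≼w , x<w

  -- Descent on the level: as long as some point strictly below escapes `A`, pass to it.
  minimal-∉ : ∀ A {w} → w ∉ members A →
              ∃[ v ] (v ∉ members A × members (v ⇓) ⊆ members A)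
  minimal-∉ A = go (<-wellFounded _)
    where
    go : ∀ {w} → Acc _<_ (level w) → w ∉ members A →
         ∃[ v ] (v ∉ members A × members (v ⇓) ⊆ members A)
    go {w} (acc rs) w∉A with em {∃[ v ] (v ∈ members (w ⇓) × v ∉ members A)}
    ... | yes (v , (_ , v<w) , v∉A) = go (rs v<w) v∉A
    ... | no  none = w , w∉A , λ {v} v∈⇓ →
      decidable-stable em λ v∉A → none (v , v∈⇓ , v∉A)

  module _ {h} {H : Pred Carrier h} (H-dense : IsDense n H) where
    open IsDense H-dense
    open IsSubalgebra isSubalgebra

    ⊆K^⇒∈H : ∀ {d} A → members A ⊆ K^ d → A ∈ H
    -- The approximation must reach one level past `d`, so that `B` has no point of level `d` + 1;
    -- freshness then excludes all higher levels.
    ⊆K^⇒∈H {d} A A⊆K^d with dense A (2^- (suc d)) (2^->0 (suc d))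
    ... | B , B∈H , r , dist , r<ε = resp (B⊆A , A⊆B) B∈H
      where
      trace≐ : members A ∩ K^ (suc d) ≐ members B ∩ K^ (suc d)
      trace≐ = distance<⇒trace≐ {A} {B} (suc d) dist r<ε

      A⊆B : members A ⊆ members B
      A⊆B x∈A = proj₁ (proj₁ trace≐ (x∈A , ℕ.m≤n⇒m≤1+n (A⊆K^d x∈A)))

      B⊆A : members B ⊆ members A
      B⊆A = trace⊆⇒⊆ B A (proj₁ ∘ proj₂ trace≐) A⊆K^d

    ↓∈H : ∀ w → w ↓ ∈ H
    ↓∈H w = ⊆K^⇒∈H (w ↓) ≼⇒level≤

    ⇓∈H : ∀ w → w ⇓ ∈ H
    ⇓∈H w = ⊆K^⇒∈H (w ⇓) (≼⇒level≤ ∘ proj₁)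

    open PrincipalSpectrum (subalgebra (F̂ n) isSubalgebra)
    open Spec⁰

    -- The basic set found here is the smallest open neighbourhood of `𝔦`, and consists of the
    -- principal primes contained in `𝔦`.
    Basic-below : (𝔦 : Spec⁰) →
                  ∃[ x ] (𝔦 ∈ Basic x × (∀ 𝔧 → 𝔧 ∈ Basic x → 𝔧 ⊆ˢ 𝔦))
    Basic-below 𝔦 with principal 𝔦
    ... | (A , _) , A≉⊤ , 𝔦⊆A , A⊆𝔦
      with em {∃[ w ] w ∉ members A}
    ... | no  none = ⊥-elim (A≉⊤
      ((λ _ → tt) , λ {w} _ → decidable-stable em λ w∉A → none (w , w∉A)))
    ... | yes (_ , w₀∉A) with minimal-∉ A w₀∉A
    ... | w , w∉A , ⇓⊆A = (w ↓ , ↓∈H w) , w↓∉𝔦 , least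
      where
      w↓∉𝔦 : (w ↓ , ↓∈H w) ∉ ideal 𝔦
      w↓∉𝔦 w↓∈𝔦 = w∉A (𝔦⊆A w↓∈𝔦 (equal ≈-refl))

      ↓⇨⇓⊆A : members (w ↓ ⇨ w ⇓) ⊆ members A
      ↓⇨⇓⊆A with prime 𝔦 (w ↓ , ↓∈H w)
        (w ↓ ⇨ w ⇓ , ⇨-closed (↓∈H w) (⇓∈H w))
        -- By modus ponens the meet lies in `w ⇓`, hence in `A` by minimality of `w`.
        (A⊆𝔦 λ (v≼w , v∈) → ⇓⊆A (v∈ (equal ≈-refl) v≼w))
      ... | inj₁ w↓∈𝔦 = contradiction w↓∈𝔦 w↓∉𝔦
      ... | inj₂ c∈𝔦  = 𝔦⊆A c∈𝔦

      least : ∀ 𝔧 → 𝔧 ∈ Basic (w ↓ , ↓∈H w) → 𝔧 ⊆ˢ 𝔦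
      least 𝔧 w↓∉𝔧 x∈𝔧 with principal 𝔧
      ... | (B , _) , _ , 𝔧⊆B , B⊆𝔧 = A⊆𝔦 λ v∈x → ↓⇨⇓⊆A
        -- If `w` were below a point `v` of a member of `𝔧`, the generator `B` would contain `w ↓`.
        (⋠⇒∈↓⇨⇓ λ w≼v → w↓∉𝔧 (B⊆𝔧 λ u≼w →
          decreasing B (≼-trans u≼w w≼v) (𝔧⊆B x∈𝔧 v∈x)))

proposition5p5 : ExcludedMiddle 0ℓ →
    ∀ {h u} (n : ℕ) → n ≥ 1 →
    (H : Pred (HeytingAlgebra.Carrier (F̂ n)) h) (H-dense : IsDense n H) →
    let open PrincipalSpectrum (subalgebra (F̂ n) (IsDense.isSubalgebra H-dense))
    in IsOpen {u = u} ≐ IsDecreasing _⊆ˢ_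
proposition5p5 em n _ H H-dense = open⇒decreasing , decreasing⇒open
  where
  open PrincipalSpectrum (subalgebra (F̂ n) (IsDense.isSubalgebra H-dense))

  open⇒decreasing : IsOpen ⊆ IsDecreasing _⊆ˢ_
  open⇒decreasing V-open 𝔦⊆𝔧 𝔧∈V with V-open 𝔧∈V
  ... | _ , x∉𝔧 , Basic⊆V = Basic⊆V (x∉𝔧 ∘ 𝔦⊆𝔧)

  decreasing⇒open : IsDecreasing _⊆ˢ_ ⊆ IsOpen
  decreasing⇒open V-decreasing {𝔦} 𝔦∈V
    with Density.Basic-below em n H-dense 𝔦
  ... | x , x∉𝔦 , below = x , x∉𝔦 , λ {𝔧} x∉𝔧 →
    V-decreasing (below 𝔧 x∉𝔧) 𝔦∈V
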